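{- Let $\vdash$ be an algebraizable logic with equivalent algebraic semantics the quasivariety $\mathbf{Y}$, and let $f$ be a selector term. Every $\mathsf{PAt}$-$f$-logic $\vdash_s$ (relative to $\vdash$) is complete with respect to its corresponding $\mathsf{PAt}$-$f$-quasivariety, i.e. for every pair $(\Gamma,\phi)$ with $\Gamma\cup\{\phi\}\subseteq Tm(\mathcal{L},\mathsf{Prop})$: $$\Gamma\vdash_s\phi \iff \mathsf{QVar}^f(\vdash_s)\vDash_f(\Gamma,\phi).$$
   Context: Let $\mathcal{L}$ be an algebraic language (function symbols with arities), $\mathsf{Prop}$ a fixed countably infinite set of variables, $Tm(\mathcal{L},\mathsf{Prop})$ the set of terms (also called formulas). A consequence relation on a set $C$ is a relation between subsets of $C$ and elements of $C$ that is reflexive ($W\vdash a$ if $a\in W$) and satisfies cut (if $W\vdash v$ for all $v\in V$ and $V\vdash a$ then $W\vdash a$); all consequence relations are assumed finitary (if $W\vdash a$ then $V\vdash a$ for some finite $V\subseteq W$). A logic is a consequence relation on $Tm(\mathcal{L},\mathsf{Prop})$ that is invariant under substitutions (endomorphisms of the term algebra). $\Lambda(\vdash)$ is the complete lattice of (finitary) logics extending $\vdash$. A quasivariety is a class of algebras closed under isomorphisms, subalgebras and reduced products. For a class $\mathbf{K}$, $\Theta\vDash_{\mathbf{K}}\gamma\approx\delta$ means that every assignment into an algebra of $\mathbf{K}$ satisfying all equations in $\Theta$ satisfies $\gamma\approx\delta$. The logic $\vdash$ is algebraizable with equivalent algebraic semantics the quasivariety $\mathbf{Y}$ (of language $\mathcal{L}$),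 witnessed by a finite set $\mu(x)$ of equations in one variable and a finite set $\Delta(x,y)$ of formulas in two variables: (1) $\Gamma\vdash\phi$ iff $\mu[\Gamma]\vDash_{\mathbf{Y}}\mu(\phi)$; (2) $\Theta\vDash_{\mathbf{Y}}\gamma\approx\delta$ iff $\Delta[\Theta]\vdash\Delta(\gamma,\delta)$; (3) $\phi\dashv\vdash\Delta[\mu(\phi)]$; (4) $\gamma\approx\delta$ and $\mu[\Delta(\gamma,\delta)]$ are $\vDash_{\mathbf{Y}}$-interderivable. Here $\mu[\Gamma]$ is the union of the sets $\mu(\psi)$ for $\psi\in\Gamma$, and $\Delta[\Theta]$ is the union of the sets $\Delta(\varepsilon,\upsilon)$ for $\varepsilon\approx\upsilon$ in $\Theta$. A unary term $f(x)$ of $\mathcal{L}$ is a selector term if it is idempotent, i.e. $f(f(x))\dashv\vdash f(x)$ (each of $f(f(x))$ and $f(x)$ is derivable from the other in $\vdash$). For a formula $\chi$, $\chi[f(\overline p)/\overline p]$ is the result of substituting $f(q)$ for each variable $q$ in $\chi$; $\Gamma[f(\overline p)/\overline p]$ is defined elementwise. For $\vdash_*\in\Lambda(\vdash)$ its $\mathsf{PAt}$-$f$-variant $\vdash_*^f$ is defined by $\Gamma\vdash_*^f\phi$ iff $\Gamma[f(\overline p)/\overline p]\vdash_*\phi[f(\overline p)/\overline p]$. A $\mathsf{PAt}$-$f$-logic is a relation of the form $\vdash_*^f$ with $\vdash_*\in\Lambda(\vdash)$. For $\mathcal{A}\in\mathbf{Y}$, $\mathcal{A}^f=\{a\in A: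 f(a)=a\}$ is the set of regular elements. A polyatomic model is a pair $(\mathcal{A},v)$ with $v:\mathsf{Prop}\to\mathcal{A}^f$. $\mathcal{A},v\vDash(\Gamma,\phi)$ means: if $\mathcal{A},v\vDash\mu[\Gamma]$ then $\mathcal{A},v\vDash\mu(\phi)$. $\mathcal{A}\vDash_f(\Gamma,\phi)$ means $\mathcal{A},v\vDash(\Gamma,\phi)$ for all polyatomic models $(\mathcal{A},v)$ on $\mathcal{A}$; $\mathbf{K}\vDash_f(\Gamma,\phi)$ means $\mathcal{A}\vDash_f(\Gamma,\phi)$ for all $\mathcal{A}\in\mathbf{K}$. The $\mathsf{PAt}$-$f$-quasivariety corresponding to $\vdash_s$ is $\mathsf{QVar}^f(\vdash_s)=\{\mathcal{A}\in\mathbf{Y}:\mathcal{A}\vDash_f(\Gamma,\phi)\text{ for all }(\Gamma,\phi)\in{\vdash_s}\}$.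
   Formalization: A selector term f is required to satisfy the identity f(f(x)) ≈ f(x) in Y, not only f(f(x)) ⊣⊢ f(x); with interderivability alone the claim fails (global modal logic KT, f(x) = □x, the formula p → □p). -}

module Defs where

open import Data.Fin.Base using (Fin)
open import Data.List.Base using (List)
import Data.List.Membership.Propositional as List
open import Data.Nat.Base using (ℕ)
open import Data.Product using (Σ; ∃-syntax; _×_; _,_; proj₁; proj₂)
open import Data.Vec.Base using (Vec; []; _∷_; map; lookup)
open import Data.Vec.Relation.Binary.Pointwise.Inductive as Pointwise using (Pointwise; []; _∷_)
open import Data.Vec.Relation.Unary.All using (All; []; _∷_)
open import Function.Bundles using (_⇔_)
open import Function.Definitions using (Bijective)
open import Level using (Level; suc; _⊔_)
open import Relation.Binary.Bundles using (Setoid)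
open import Relation.Binary.Definitions using (_Respects_)
open import Relation.Binary.PropositionalEquality using (_≡_)
open import Relation.Unary using (Pred; _∈_; _⊆_; _∩_; ｛_｝; Satisfiable)
open import Relation.Unary.Polymorphic using (∅; U)

-- "Set" is read as "Set ℓ" (setoids over it, for the carriers of algebras),
-- for one arbitrary level ℓ; a subset of C is a Pred C ℓ.

------------------------------------------------------------------------
-- Languages and terms

record Language (ℓ : Level) : Set (suc ℓ) where
  field
    Op    : Set ℓ
    arity : Op → ℕ

data Term {ℓ : Level} (L : Language ℓ) (X : Set) : Set ℓ where
  var : X → Term L X
  op  : (o : Language.Op L) → Vec (Term L X) (Language.arity L o) → Term L X

Propn : Set
Propn = ℕ

Fm : {ℓ : Level} → Language ℓ → Set ℓ
Fm L = Term L Propn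

-- γ ≈ δ is the pair (γ , δ).
Equation : {ℓ : Level} → Language ℓ → Set → Set ℓ
Equation L X = Term L X × Term L X

module _ {ℓ : Level} {L : Language ℓ} where
  open Language L

  infixl 8 _[_] _⟨_⟩ _⟨_∣_⟩

  mutual
    _[_] : {X Y : Set} → Term L X → (X → Term L Y) → Term L Y
    var x   [ σ ] = σ x
    op o ts [ σ ] = op o (substs ts σ)

    substs : {X Y : Set} {n : ℕ} → Vec (Term L X) n → (X → Term L Y) → Vec (Term L Y) n
    substs []       σ = []
    substs (t ∷ ts) σ = (t [ σ ]) ∷ substs ts σ

  _⟨_⟩ : {X : Set} → Term L (Fin 1) → Term L X → Term L X
  t ⟨ s ⟩ = t [ (λ _ → s) ]

  _⟨_∣_⟩ : {X : Set} → Term L (Fin 2) → Term L X → Term L X → Term L X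
  t ⟨ r ∣ s ⟩ = t [ lookup (r ∷ s ∷ []) ]

  -- The direct image σ[Γ].
  _[_]ₛ : Pred (Fm L) ℓ → (Propn → Fm L) → Pred (Fm L) ℓ
  (Γ [ σ ]ₛ) χ = ∃[ ψ ] (ψ ∈ Γ × χ ≡ ψ [ σ ])

  -- The substitution f(p̄)/p̄.
  at : Term L (Fin 1) → Propn → Fm L
  at f q = f ⟨ var q ⟩

------------------------------------------------------------------------
-- Consequence relations and logics

fromList : {ℓ : Level} {C : Set ℓ} → List C → Pred C ℓ
fromList xs x = x List.∈ xs

Relation : {ℓ : Level} → Set ℓ → Set (suc ℓ)
Relation {ℓ} C = Pred C ℓ → C → Set ℓ

record IsConsequenceRelation {ℓ : Level} {C : Set ℓ} (_⊢_ : Relation C) : Set (suc ℓ) where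
  field
    reflexive : ∀ {W a} → a ∈ W → W ⊢ a
    cut       : ∀ {W V a} → (∀ {v} → v ∈ V → W ⊢ v) → V ⊢ a → W ⊢ a
    finitary  : ∀ {W a} → W ⊢ a → ∃[ vs ] (fromList vs ⊆ W × fromList vs ⊢ a)

record IsLogic {ℓ : Level} {L : Language ℓ} (_⊢_ : Relation (Fm L)) : Set (suc ℓ) where
  field
    isConsequenceRelation : IsConsequenceRelation _⊢_
    structural            : ∀ (σ : Propn → Fm L) {Γ φ} → Γ ⊢ φ → (Γ [ σ ]ₛ) ⊢ (φ [ σ ])

  open IsConsequenceRelation isConsequenceRelation public

-- _⊢*_ ∈ Λ(⊢)
record IsExtension {ℓ : Level} {L : Language ℓ} (_⊢_ _⊢*_ : Relation (Fm L)) : Set (suc ℓ) where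
  field
    isLogic : IsLogic _⊢*_
    extends : ∀ {Γ φ} → Γ ⊢ φ → Γ ⊢* φ

------------------------------------------------------------------------
-- Algebras

-- Algebras are nonempty, as usual; the witness plays no role in homomorphisms
-- or subalgebras.
record Algebra {ℓ : Level} (L : Language ℓ) : Set (suc ℓ) where
  open Language L
  field
    setoid : Setoid ℓ ℓ
  open Setoid setoid public renaming (refl to ≈-refl; sym to ≈-sym; trans to ≈-trans)
  field
    ⟦_⟧      : (o : Op) → Vec Carrier (arity o) → Carrier
    ⟦⟧-cong  : (o : Op) {as bs : Vec Carrier (arity o)} →
               Pointwise _≈_ as bs → ⟦ o ⟧ as ≈ ⟦ o ⟧ bs
    nonempty : Carrier

-- Filters need not be proper and index sets may be empty, so a trivial
-- algebra is a reduced product.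
record IsFilter {ℓ : Level} {I : Set ℓ} (F : Pred (Pred I ℓ) ℓ) : Set (suc ℓ) where
  field
    full   : U ∈ F
    upward : ∀ {P Q} → P ⊆ Q → P ∈ F → Q ∈ F
    meet   : ∀ {P Q} → P ∈ F → Q ∈ F → (P ∩ Q) ∈ F

module _ {ℓ : Level} {L : Language ℓ} where
  open Language L
  open Algebra using (Carrier)

  mutual
    eval : (A : Algebra L) {X : Set} → (X → Carrier A) → Term L X → Carrier A
    eval A v (var x)   = v x
    eval A v (op o ts) = Algebra.⟦_⟧ A o (evals A v ts)

    evals : (A : Algebra L) {X : Set} {n : ℕ} →
            (X → Carrier A) → Vec (Term L X) n → Vec (Carrier A) n
    evals A v []       = []
    evals A v (t ∷ ts) = eval A v t ∷ evals A v ts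

  record _≅_ (A B : Algebra L) : Set ℓ where
    private
      module A = Algebra A
      module B = Algebra B
    field
      to        : A.Carrier → B.Carrier
      homo      : ∀ o as → to (A.⟦ o ⟧ as) B.≈ B.⟦ o ⟧ (map to as)
      bijective : Bijective A._≈_ B._≈_ to
      cong      : ∀ {a b} → a A.≈ b → to a B.≈ to b

  record IsSubuniverse (A : Algebra L) (S : Pred (Carrier A) ℓ) : Set ℓ where
    open Algebra A hiding (Carrier)
    field
      respects  : S Respects _≈_
      closed    : ∀ o as → All S as → ⟦ o ⟧ as ∈ S
      inhabited : Satisfiable S

  subalgebra : (A : Algebra L) (S : Pred (Carrier A) ℓ) → IsSubuniverse A S → Algebra L
  subalgebra A S isSub = record
    { setoid   = record
      { Carrier       = Σ (Carrier A) S
      ; _≈_           = λ a b → proj₁ a ≈ proj₁ b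
      ; isEquivalence = record { refl = ≈-refl ; sym = ≈-sym ; trans = ≈-trans }
      }
    ; ⟦_⟧      = λ o as → ⟦ o ⟧ (map proj₁ as) , closed o (map proj₁ as) (members as)
    ; ⟦⟧-cong  = λ o ps → ⟦⟧-cong o (Pointwise.map⁺ (λ p → p) ps)
    ; nonempty = inhabited
    }
    where
    open Algebra A hiding (Carrier)
    open IsSubuniverse isSub

    members : ∀ {n} (as : Vec (Σ (Carrier A) S) n) → All S (map proj₁ as)
    members []       = []
    members (a ∷ as) = proj₂ a ∷ members as

  reducedProduct : {I : Set ℓ} (A : I → Algebra L) (F : Pred (Pred I ℓ) ℓ) → IsFilter F → Algebra L
  reducedProduct {I} A F isFilter = record
    { setoid   = record
      { Carrier       = ∀ i → A.Carrier i
      ; _≈_           = _~_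
      ; isEquivalence = record
        { refl  = upward (λ {i} _ → A.≈-refl i) full
        ; sym   = upward (λ {i} → A.≈-sym i)
        ; trans = λ p q → upward (λ {i} (r , s) → A.≈-trans i r s) (meet p q)
        }
      }
    ; ⟦_⟧      = λ o as i → A.⟦_⟧ i o (map (λ a → a i) as)
    ; ⟦⟧-cong  = λ o ps → upward (λ {i} → A.⟦⟧-cong i o) (pointwise ps)
    ; nonempty = λ i → A.nonempty i
    }
    where
    module A i = Algebra (A i)
    open IsFilter isFilter

    _~_ : (a b : ∀ i → A.Carrier i) → Set ℓ
    a ~ b = (λ i → A._≈_ i (a i) (b i)) ∈ F

    pointwise : ∀ {n} {as bs : Vec (∀ i → A.Carrier i) n} → Pointwise _~_ as bs →
                (λ i → Pointwise (A._≈_ i) (map (λ a → a i) as) (map (λ b → b i) bs)) ∈ F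
    pointwise []       = upward (λ _ → []) full
    pointwise (p ∷ ps) = upward (λ (q , qs) → q ∷ qs) (meet p (pointwise ps))

  record IsQuasivariety {y : Level} (Y : Pred (Algebra L) y) : Set (suc ℓ ⊔ y) where
    field
      isomorphisms    : ∀ {A B} → A ≅ B → A ∈ Y → B ∈ Y
      subalgebras     : ∀ {A} S (isSub : IsSubuniverse A S) → A ∈ Y → subalgebra A S isSub ∈ Y
      reducedProducts : ∀ {I : Set ℓ} (A : I → Algebra L) F (isFilter : IsFilter F) →
                        (∀ i → A i ∈ Y) → reducedProduct A F isFilter ∈ Y

  _∣_⊨_ : (A : Algebra L) → (Propn → Carrier A) → Equation L Propn → Set ℓ
  A ∣ v ⊨ (γ , δ) = eval A v γ ≈ eval A v δ
    where open Algebra A using (_≈_)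

  _⊨[_]_ : {y : Level} → Pred (Equation L Propn) ℓ → Pred (Algebra L) y → Equation L Propn → Set (suc ℓ ⊔ y)
  Θ ⊨[ K ] ε = ∀ {A} → A ∈ K → (v : Propn → Carrier A) → (∀ {θ} → θ ∈ Θ → A ∣ v ⊨ θ) → A ∣ v ⊨ ε

------------------------------------------------------------------------
-- Algebraizability

  module Transformers (μ : List (Equation L (Fin 1))) (Δ : List (Term L (Fin 2))) where

    μ⟨_⟩ : Fm L → Pred (Equation L Propn) ℓ
    μ⟨ φ ⟩ ε = ∃[ s ] ∃[ t ] ((s , t) List.∈ μ × ε ≡ (s ⟨ φ ⟩ , t ⟨ φ ⟩))

    μ[_] : Pred (Fm L) ℓ → Pred (Equation L Propn) ℓ
    μ[ Γ ] ε = ∃[ ψ ] (ψ ∈ Γ × ε ∈ μ⟨ ψ ⟩)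

    Δ⟨_⟩ : Equation L Propn → Pred (Fm L) ℓ
    Δ⟨ γ , δ ⟩ χ = ∃[ t ] (t List.∈ Δ × χ ≡ t ⟨ γ ∣ δ ⟩)

    Δ[_] : Pred (Equation L Propn) ℓ → Pred (Fm L) ℓ
    Δ[ Θ ] χ = ∃[ ε ] (ε ∈ Θ × χ ∈ Δ⟨ ε ⟩)

  record IsAlgebraizable {y : Level} (_⊢_ : Relation (Fm L)) (Y : Pred (Algebra L) y) : Set (suc ℓ ⊔ y) where
    field
      μ : List (Equation L (Fin 1))
      Δ : List (Term L (Fin 2))
    open Transformers μ Δ public
    field
      ⊢⇔⊨ : ∀ Γ φ → (Γ ⊢ φ) ⇔ (∀ {ε} → ε ∈ μ⟨ φ ⟩ → μ[ Γ ] ⊨[ Y ] ε)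
      ⊨⇔⊢ : ∀ Θ ε → (Θ ⊨[ Y ] ε) ⇔ (∀ {χ} → χ ∈ Δ⟨ ε ⟩ → Δ[ Θ ] ⊢ χ)
      ⊢Δμ  : ∀ φ {χ} → χ ∈ Δ[ μ⟨ φ ⟩ ] → ｛ φ ｝ ⊢ χ
      Δμ⊢  : ∀ φ → Δ[ μ⟨ φ ⟩ ] ⊢ φ
      ⊨μΔ  : ∀ ε {η} → η ∈ μ[ Δ⟨ ε ⟩ ] → ｛ ε ｝ ⊨[ Y ] η
      μΔ⊨  : ∀ ε → μ[ Δ⟨ ε ⟩ ] ⊨[ Y ] ε

------------------------------------------------------------------------
-- Polyatomic logics and their quasivarieties

  -- Interderivability of f(f(x)) and f(x) alone is too weak: it does not make
  -- f(a) a regular element.  In the global modal logic of reflexive frames,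
  -- □□x and □x are interderivable, but □p → □□p is not a theorem, although
  -- p → □p holds in every algebra under every valuation fixed by □.  Idempotence
  -- is therefore the identity f(f(x)) ≈ f(x) of Y, which implies
  -- interderivability.
  record IsSelector {y : Level} (_⊢_ : Relation (Fm L)) (Y : Pred (Algebra L) y)
                    (f : Term L (Fin 1)) : Set (suc ℓ ⊔ y) where
    private
      x : Fm L
      x = var 0
    field
      ff⊢f       : ｛ f ⟨ f ⟨ x ⟩ ⟩ ｝ ⊢ (f ⟨ x ⟩)
      f⊢ff       : ｛ f ⟨ x ⟩ ｝ ⊢ (f ⟨ f ⟨ x ⟩ ⟩)
      idempotent : ∅ ⊨[ Y ] (f ⟨ f ⟨ x ⟩ ⟩ , f ⟨ x ⟩)

  variant : Term L (Fin 1) → Relation (Fm L) → Relation (Fm L)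
  variant f _⊢*_ Γ φ = (Γ [ at f ]ₛ) ⊢* (φ [ at f ])

  -- Relations are identified when they have the same pairs.
  IsPAtLogic : Relation (Fm L) → Term L (Fin 1) → Relation (Fm L) → Set (suc ℓ)
  IsPAtLogic _⊢_ f _⊢ₛ_ =
    ∃[ _⊢*_ ] (IsExtension _⊢_ _⊢*_ × (∀ Γ φ → (Γ ⊢ₛ φ) ⇔ variant f _⊢*_ Γ φ))

  Regular : Term L (Fin 1) → (A : Algebra L) → Pred (Carrier A) ℓ
  Regular f A a = eval A (λ _ → a) f ≈ a
    where open Algebra A using (_≈_)

  module Polyatomic {y : Level} {_⊢_ : Relation (Fm L)} {Y : Pred (Algebra L) y}
                    (alg : IsAlgebraizable _⊢_ Y) (f : Term L (Fin 1)) where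
    open IsAlgebraizable alg

    _⊨f_ : Algebra L → Pred (Fm L) ℓ × Fm L → Set ℓ
    A ⊨f (Γ , φ) = (v : Propn → Carrier A) → (∀ p → v p ∈ Regular f A) →
                   (∀ {ε} → ε ∈ μ[ Γ ] → A ∣ v ⊨ ε) → (∀ {ε} → ε ∈ μ⟨ φ ⟩ → A ∣ v ⊨ ε)

    _⊨ᶠ_ : {k : Level} → Pred (Algebra L) k → Pred (Fm L) ℓ × Fm L → Set (suc ℓ ⊔ k)
    K ⊨ᶠ r = ∀ {A} → A ∈ K → A ⊨f r

    QVar : Relation (Fm L) → Pred (Algebra L) (suc ℓ ⊔ y)
    QVar _⊢ₛ_ A = A ∈ Y × (∀ {Γ φ} → Γ ⊢ₛ φ → A ⊨f (Γ , φ))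

{-# OPTIONS --safe #-}
module Submission where

-- Soundness is the definition of the quasivariety of a logic.  For
-- completeness, let the variant come from the extension ⊢*, and let T be the
-- set of all χ with Γ[f(p)/p] ⊢* χ.  As ⊢* extends ⊢, T is a theory of ⊢, so
-- algebraizability yields an algebra A of Y and a valuation v whose values
-- generate A, such that v satisfies μ(χ) exactly when χ lies in T
-- (theory⇒satisfied and satisfied⇒theory).  It plays the part of the
-- Lindenbaum-Tarski algebra of T.
--
-- A belongs to the quasivariety of the variant (generic-rules): a regular
-- valuation w on A sends each p to the value of some term τ(p), and by
-- regularity also to the value of f(τ(p)).  Hence a formula ψ has under w the
-- value that ψ[f(p)/p][τ] has under v (eval-at-regular), and a rule of the
-- variant becomes a substitution instance of a rule of ⊢*, under which T is
-- closed.
--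
-- Finally, p ↦ f(v(p)) is a regular valuation because f is idempotent on Y.
-- Under it ψ has the value of ψ[f(p)/p] under v; so it satisfies μ[Γ], hence
-- μ(φ), which says that φ[f(p)/p] lies in T (valid⇒theory).
--
-- The pair (A , v) is found without forming a quotient of the term algebra.
-- Each equation that does not follow over Y from μ[T] has a countermodel;
-- A is the subalgebra of the product of these countermodels generated by the
-- tuple of their valuations (genericModel).

open import Axiom.ExcludedMiddle using (ExcludedMiddle)
open import Data.Fin.Base using (Fin)
open import Data.Nat.Base using (ℕ)
open import Data.Product using (Σ; ∃-syntax; _,_; proj₁; proj₂)
open import Data.Vec.Base using (Vec; []; _∷_; map)
open import Data.Vec.Properties using (map-∘)
open import Data.Vec.Relation.Binary.Pointwise.Inductive using (Pointwise; []; _∷_)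
open import Data.Vec.Relation.Unary.All using (All; []; _∷_)
open import Function.Bundles using (_⇔_; mk⇔; Equivalence)
open import Level using (Level; suc; _⊔_; Lift; lift; lower)
open import Relation.Binary.PropositionalEquality using (_≡_; refl; sym; trans; cong; cong₂; subst₂)
open import Relation.Nullary.Decidable using (True; toWitness; fromWitness; map′; decidable-stable)
open import Relation.Nullary.Negation using (¬_)
open import Relation.Unary using (Pred; _∈_)
open import Defs

-- Evaluation of terms

module _ {ℓ : Level} {L : Language ℓ} where
  open Language L
  open Algebra using (Carrier; ⟦_⟧)

  module _ (A : Algebra L) where
    open Algebra A using (_≈_; ⟦⟧-cong)

    mutual
      eval-[] : {X Y : Set} (v : Y → Carrier A) (σ : X → Term L Y) (t : Term L X) →
                eval A v (t [ σ ]) ≡ eval A (λ x → eval A v (σ x)) t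
      eval-[] v σ (var x)   = refl
      eval-[] v σ (op o ts) = cong (⟦ A ⟧ o) (evals-[] v σ ts)

      evals-[] : {X Y : Set} (v : Y → Carrier A) (σ : X → Term L Y) {n : ℕ} (ts : Vec (Term L X) n) →
                 evals A v (substs ts σ) ≡ evals A (λ x → eval A v (σ x)) ts
      evals-[] v σ []       = refl
      evals-[] v σ (t ∷ ts) = cong₂ _∷_ (eval-[] v σ t) (evals-[] v σ ts)

    mutual
      eval-cong : {X : Set} {v w : X → Carrier A} → (∀ x → v x ≈ w x) →
                  (t : Term L X) → eval A v t ≈ eval A w t
      eval-cong v≈w (var x)   = v≈w x
      eval-cong v≈w (op o ts) = ⟦⟧-cong o (evals-cong v≈w ts)

      evals-cong : {X : Set} {v w : X → Carrier A} → (∀ x → v x ≈ w x) →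
                   {n : ℕ} (ts : Vec (Term L X) n) → Pointwise _≈_ (evals A v ts) (evals A w ts)
      evals-cong v≈w []       = []
      evals-cong v≈w (t ∷ ts) = eval-cong v≈w t ∷ evals-cong v≈w ts

  module _ (A B : Algebra L) (h : Carrier A → Carrier B)
           (homo : ∀ o as → h (⟦ A ⟧ o as) ≡ ⟦ B ⟧ o (map h as)) where

    mutual
      eval-homo : {X : Set} (v : X → Carrier A) (t : Term L X) →
                  h (eval A v t) ≡ eval B (λ x → h (v x)) t
      eval-homo v (var x)   = refl
      eval-homo v (op o ts) = trans (homo o (evals A v ts)) (cong (⟦ B ⟧ o) (evals-homo v ts))

      evals-homo : {X : Set} (v : X → Carrier A) {n : ℕ} (ts : Vec (Term L X) n) →
                   map h (evals A v ts) ≡ evals B (λ x → h (v x)) ts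
      evals-homo v []       = refl
      evals-homo v (t ∷ ts) = cong₂ _∷_ (eval-homo v t) (evals-homo v ts)

-- Products and generated subalgebras

  module _ (A : Algebra L) (v : Propn → Carrier A) where
    open Algebra A using (_≈_; ≈-refl; ≈-sym; ≈-trans; ⟦⟧-cong)

    Generated : Pred (Carrier A) ℓ
    Generated a = ∃[ t ] (a ≈ eval A v t)

    generated-isSubuniverse : IsSubuniverse A Generated
    generated-isSubuniverse = record
      { respects  = λ a≈b (t , a≈t) → t , ≈-trans (≈-sym a≈b) a≈t
      ; closed    = λ o as gs → let (ts , as≈ts) = names gs in op o ts , ⟦⟧-cong o as≈ts
      ; inhabited = v 0 , var 0 , ≈-refl
      }
      where
      names : ∀ {n} {as : Vec (Carrier A) n} → All Generated as →
              Σ (Vec (Fm L) n) λ ts → Pointwise _≈_ as (evals A v ts)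
      names []             = [] , []
      names ((t , p) ∷ gs) = let (ts , ps) = names gs in t ∷ ts , p ∷ ps

  -- Direct products are the reduced products over the least filter.
  least-isFilter : {I : Set ℓ} → IsFilter {I = I} (λ P → ∀ i → P i)
  least-isFilter = record
    { full   = λ _ → lift _
    ; upward = λ P⊆Q p i → P⊆Q (p i)
    ; meet   = λ p q i → p i , q i
    }

-- Generic models

  -- What the quotient of the term algebra by the equations that follow from Θ
  -- over Y provides, with v the quotient map on variables.
  record GenericModel {y : Level} (Y : Pred (Algebra L) y) (Θ : Pred (Equation L Propn) ℓ) :
                      Set (suc ℓ ⊔ y) where
    field
      A         : Algebra L
      A∈Y       : A ∈ Y
      v         : Propn → Carrier A
      generated : ∀ a → ∃[ t ] Algebra._≈_ A a (eval A v t)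
      satisfies : ∀ {θ} → θ ∈ Θ → A ∣ v ⊨ θ
      generic   : ∀ ε → A ∣ v ⊨ ε → Θ ⊨[ Y ] ε

  record Countermodel {y : Level} (Y : Pred (Algebra L) y) (Θ : Pred (Equation L Propn) ℓ)
                      (ε : Equation L Propn) : Set (suc ℓ ⊔ y) where
    constructor countermodel
    field
      B         : Algebra L
      B∈Y       : B ∈ Y
      v         : Propn → Carrier B
      satisfies : ∀ {θ} → θ ∈ Θ → B ∣ v ⊨ θ
      refutes   : ¬ (B ∣ v ⊨ ε)

  -- An equation true in the product of all chosen countermodels has no
  -- countermodel, since its own one would be among the factors.
  genericModel : {y : Level} → ExcludedMiddle (suc ℓ ⊔ y) →
                 {Y : Pred (Algebra L) y} → IsQuasivariety Y →
                 (Θ : Pred (Equation L Propn) ℓ) → GenericModel Y Θ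
  genericModel {y} em {Y} isQuasivariety Θ = record
    { A         = A
    ; A∈Y       = subalgebras _ (generated-isSubuniverse P u)
                    (reducedProducts B _ least-isFilter (λ i → Countermodel.B∈Y (chosen i)))
    ; v         = v
    ; generated = λ (a , t , a≈t) →
                    t , λ i → subst₂ (Algebra._≈_ (B i)) refl
                                (trans (eval-homo P (B i) (λ a → a i) (λ _ _ → refl) u t)
                                       (sym (eval-π i t)))
                                (a≈t i)
    ; satisfies = λ {θ} θ∈Θ i → from-coordinate i θ (Countermodel.satisfies (chosen i) θ∈Θ)
    ; generic   = λ ε ⊨ε {C} C∈Y w w⊨Θ → decidable-stable (map′ lower lift (em {Lift (suc ℓ ⊔ y) _}))
                    λ w⊭ε → let i = ε , fromWitness (countermodel C C∈Y w w⊨Θ w⊭ε) in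
                      Countermodel.refutes (chosen i) (to-coordinate i ε (⊨ε i))
    }
    where
    open IsQuasivariety isQuasivariety

    -- The truth value of the decision, unlike the statement that a
    -- countermodel exists, is small enough for an index set at level ℓ.
    I : Set ℓ
    I = Σ (Equation L Propn) λ ε → True (em {Countermodel Y Θ ε})

    chosen : (i : I) → Countermodel Y Θ (proj₁ i)
    chosen (ε , c) = toWitness c

    B : I → Algebra L
    B i = Countermodel.B (chosen i)

    P : Algebra L
    P = reducedProduct B _ least-isFilter

    u : Propn → Carrier P
    u p i = Countermodel.v (chosen i) p

    A : Algebra L
    A = subalgebra P (Generated P u) (generated-isSubuniverse P u)

    v : Propn → Carrier A
    v p = u p , var p , Algebra.≈-refl P {u p}

    π : (i : I) → Carrier A → Carrier (B i)
    π i a = proj₁ a i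

    eval-π : ∀ i t → π i (eval A v t) ≡ eval (B i) (Countermodel.v (chosen i)) t
    eval-π i = eval-homo A (B i) (π i)
                 (λ o as → cong (⟦ B i ⟧ o) (sym (map-∘ (λ a → a i) proj₁ as))) v

    to-coordinate : ∀ i ((γ , δ) : Equation L Propn) →
                    Algebra._≈_ (B i) (π i (eval A v γ)) (π i (eval A v δ)) →
                    B i ∣ Countermodel.v (chosen i) ⊨ (γ , δ)
    to-coordinate i (γ , δ) = subst₂ (Algebra._≈_ (B i)) (eval-π i γ) (eval-π i δ)

    from-coordinate : ∀ i ((γ , δ) : Equation L Propn) →
                      B i ∣ Countermodel.v (chosen i) ⊨ (γ , δ) →
                      Algebra._≈_ (B i) (π i (eval A v γ)) (π i (eval A v δ))
    from-coordinate i (γ , δ) =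
      subst₂ (Algebra._≈_ (B i)) (sym (eval-π i γ)) (sym (eval-π i δ))

-- Satisfaction of formulas and regular elements

  module _ (A : Algebra L) (f : Term L (Fin 1)) where
    open Algebra A using (_≈_; ≈-refl; ≈-sym; ≈-trans)

    eval-at : (v : Propn → Carrier A) (ψ : Fm L) →
              eval A v (ψ [ at f ]) ≈ eval A (λ p → eval A (λ _ → v p) f) ψ
    eval-at v ψ = subst₂ _≈_ (sym (eval-[] A v (at f) ψ)) refl
      (eval-cong A (λ p → subst₂ _≈_ (sym (eval-[] A v _ f)) refl ≈-refl) ψ)

    -- When f fixes the values of w, putting f in front of the terms that name
    -- them does not change the value of a formula.
    eval-at-regular : {v w : Propn → Carrier A} → (∀ p → w p ∈ Regular f A) →
                      (τ : Propn → Fm L) → (∀ p → w p ≈ eval A v (τ p)) → (ψ : Fm L) →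
                      eval A v (ψ [ at f ] [ τ ]) ≈ eval A w ψ
    eval-at-regular {v} w-regular τ w≈τ ψ =
      subst₂ _≈_ (sym (eval-[] A v τ (ψ [ at f ]))) refl
        (≈-trans (eval-at (λ p → eval A v (τ p)) ψ)
          (eval-cong A
            (λ p → ≈-trans (eval-cong A (λ _ → ≈-sym (w≈τ p)) f) (w-regular p)) ψ))

  module _ {y : Level} {_⊢_ : Relation (Fm L)} {Y : Pred (Algebra L) y}
           (alg : IsAlgebraizable _⊢_ Y) where
    open IsAlgebraizable alg

    Satisfies : (A : Algebra L) → (Propn → Carrier A) → Fm L → Set ℓ
    Satisfies A v φ = ∀ {ε} → ε ∈ μ⟨ φ ⟩ → A ∣ v ⊨ ε

    -- The equations of μ see a formula only through its value.
    satisfies-resp : (A : Algebra L) {v w : Propn → Carrier A} (φ ψ : Fm L) →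
                     Algebra._≈_ A (eval A v φ) (eval A w ψ) →
                     Satisfies A v φ → Satisfies A w ψ
    satisfies-resp A {v} {w} φ ψ φ≈ψ sat (s , t , st∈μ , refl) =
      ≈-trans (≈-sym (value s)) (≈-trans (sat (s , t , st∈μ , refl)) (value t))
      where
      open Algebra A using (_≈_; ≈-sym; ≈-trans)

      value : (s : Term L (Fin 1)) → eval A v (s ⟨ φ ⟩) ≈ eval A w (s ⟨ ψ ⟩)
      value s = subst₂ _≈_ (sym (eval-[] A v _ s)) (sym (eval-[] A w _ s))
                  (eval-cong A (λ _ → φ≈ψ) s)

    -- Idempotence is an identity in one variable; evaluating that variable
    -- at a gives f(f(a)) ≈ f(a).
    selected-regular : {f : Term L (Fin 1)} → IsSelector _⊢_ Y f → {A : Algebra L} → A ∈ Y →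
                       (a : Carrier A) → eval A (λ _ → a) f ∈ Regular f A
    selected-regular {f} isSelector {A} A∈Y a =
      subst₂ (Algebra._≈_ A)
        (trans (eval-[] A v _ f) (cong (λ b → eval A (λ _ → b) f) (eval-[] A v _ f)))
        (eval-[] A v _ f)
        (IsSelector.idempotent isSelector A∈Y v (λ ()))
      where
      v : Propn → Carrier A
      v _ = a

-- Completeness

    module Completeness
      {f : Term L (Fin 1)} (isSelector : IsSelector _⊢_ Y f)
      {_⊢*_ : Relation (Fm L)} (isExtension : IsExtension _⊢_ _⊢*_)
      (Ξ : Pred (Fm L) ℓ) (model : GenericModel Y μ[ (λ χ → Ξ ⊢* χ) ]) where
      open Polyatomic alg f
      open IsExtension isExtension
      open IsLogic isLogic
      open GenericModel model
      open Algebra A using (≈-sym)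

      Theory : Pred (Fm L) ℓ
      Theory χ = Ξ ⊢* χ

      theory⇒satisfied : ∀ {χ} → χ ∈ Theory → Satisfies A v χ
      theory⇒satisfied {χ} χ∈T ε∈μχ = satisfies (χ , χ∈T , ε∈μχ)

      -- By genericity μ(χ) follows from μ[T] over Y, so T ⊢ χ, and T is closed
      -- under ⊢ because ⊢* extends ⊢.
      satisfied⇒theory : ∀ {χ} → Satisfies A v χ → χ ∈ Theory
      satisfied⇒theory {χ} sat =
        cut (λ ψ∈T → ψ∈T)
          (extends (Equivalence.from (⊢⇔⊨ Theory χ) (λ {ε} ε∈μχ → generic ε (sat ε∈μχ))))

      generic-rules : ∀ {Γ φ} → variant f _⊢*_ Γ φ → A ⊨f (Γ , φ)
      generic-rules {Γ} {φ} Γ⊢φ w w-regular w⊨Γ =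
        satisfies-resp A (φ [ at f ] [ τ ]) φ (value φ)
          (theory⇒satisfied (cut premises (structural τ Γ⊢φ)))
        where
        τ : Propn → Fm L
        τ p = proj₁ (generated (w p))

        value : ∀ ψ → Algebra._≈_ A (eval A v (ψ [ at f ] [ τ ])) (eval A w ψ)
        value = eval-at-regular A f w-regular τ (λ p → proj₂ (generated (w p)))

        premises : ∀ {χ} → χ ∈ Γ [ at f ]ₛ [ τ ]ₛ → χ ∈ Theory
        premises (_ , (ψ , ψ∈Γ , refl) , refl) = satisfied⇒theory
          (satisfies-resp A ψ (ψ [ at f ] [ τ ]) (≈-sym (value ψ))
            (λ ε∈μψ → w⊨Γ (ψ , ψ∈Γ , ε∈μψ)))

      generic∈QVar : QVar (variant f _⊢*_) A
      generic∈QVar = A∈Y , generic-rules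

      -- Validity in A is applied to the regular valuation p ↦ f(v(p)).
      valid⇒theory : ∀ {Γ φ} → (∀ {ψ} → ψ ∈ Γ → (ψ [ at f ]) ∈ Theory) →
                     A ⊨f (Γ , φ) → (φ [ at f ]) ∈ Theory
      valid⇒theory {φ = φ} Γ⊆T A⊨Γφ = satisfied⇒theory
        (satisfies-resp A φ (φ [ at f ]) (≈-sym (eval-at A f v φ))
          (A⊨Γφ _ (λ p → selected-regular isSelector A∈Y (v p))
            λ (ψ , ψ∈Γ , ε∈μψ) →
              satisfies-resp A (ψ [ at f ]) ψ (eval-at A f v ψ) (theory⇒satisfied (Γ⊆T ψ∈Γ)) ε∈μψ))

theorem3p26 : {ℓ y : Level} → ExcludedMiddle (suc ℓ ⊔ y) →
    {L : Language ℓ} (_⊢_ : Relation (Fm L)) → IsLogic _⊢_ →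
    (Y : Pred (Algebra L) y) → IsQuasivariety Y →
    (alg : IsAlgebraizable _⊢_ Y) →
    (f : Term L (Fin 1)) → IsSelector _⊢_ Y f →
    (_⊢ₛ_ : Relation (Fm L)) → IsPAtLogic _⊢_ f _⊢ₛ_ →
    (Γ : Pred (Fm L) ℓ) (φ : Fm L) →
    let open Polyatomic alg f in
    (Γ ⊢ₛ φ) ⇔ (QVar _⊢ₛ_ ⊨ᶠ (Γ , φ))
theorem3p26 em _⊢_ _ Y isQuasivariety alg f isSelector _⊢ₛ_ (_⊢*_ , isExtension , ⊢ₛ⇔variant) Γ φ =
  mk⇔ sound completeness
  where
  open Polyatomic alg f
  open IsExtension isExtension using (isLogic)
  open IsLogic isLogic using (reflexive)
  open Completeness alg isSelector isExtension (Γ [ at f ]ₛ) (genericModel em isQuasivariety _)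

  sound : Γ ⊢ₛ φ → QVar _⊢ₛ_ ⊨ᶠ (Γ , φ)
  sound Γ⊢φ (_ , rules) = rules Γ⊢φ

  completeness : QVar _⊢ₛ_ ⊨ᶠ (Γ , φ) → Γ ⊢ₛ φ
  completeness valid = Equivalence.from (⊢ₛ⇔variant Γ φ)
    (valid⇒theory (λ {ψ} ψ∈Γ → reflexive (ψ , ψ∈Γ , refl))
      (valid (proj₁ generic∈QVar , λ {Γ′} {φ′} Γ′⊢φ′ →
        generic-rules (Equivalence.to (⊢ₛ⇔variant Γ′ φ′) Γ′⊢φ′))))
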